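{- For every $d \in \{2,3,4,5,7,8,9,12,16,24,56,72\}$, the sequence $\left(\left\lfloor n^6/d \right\rfloor\right)_{n \ge 1}$ is eventually prime-free.
   Context: A sequence $(a_n)_{n\ge 1}$ of positive integers is called eventually prime-free if there exists an index $n_0$ such that $a_n$ is composite for all $n \ge n_0$. (Here, as in the paper, this is understood as: only finitely many terms $a_n$ are prime.) -}

module Defs where

open import Data.Nat using (ℕ; _≥_)
open import Data.Nat.Primality using (Composite)
open import Data.Product using (∃-syntax; _×_)

-- Sequences (aₙ)_{n ≥ 1} are functions on ℕ whose value at 0 is irrelevant:
-- the threshold n₀ must itself be an index, i.e. n₀ ≥ 1.
EventuallyPrimeFree : (ℕ → ℕ) → Set
EventuallyPrimeFree a = ∃[ n₀ ] (n₀ ≥ 1 × (∀ n → n ≥ n₀ → Composite (a n)))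

{-# OPTIONS --safe #-}
module Submission where

open import Data.Nat using (ℕ; zero; suc; _+_; _*_; _∸_; _^_; _/_; _%_; _≤_; _<_; _≟_; s≤s; NonZero; >-nonZero; >-nonZero⁻¹; n>1⇒nonTrivial)
open import Data.Nat.Properties
open import Data.Nat.DivMod using (m≡m%n+[m/n]*n; m%n<n; %-distribˡ-*; m%n%n≡m%n)
open import Data.Nat.Divisibility using (_∣_; divides; divides-refl)
open import Data.Nat.Primality using (Prime; Composite; euclidsLemma; ¬prime⇒composite; prime⇒nonZero)
open import Data.Nat.Tactic.RingSolver using (solve-∀)
open import Data.List using ([]; _∷_)
open import Data.List.Membership.Propositional using (_∈_)
open import Data.List.Relation.Unary.All using (All; []; _∷_; lookup)
open import Data.Product using (∃-syntax; _×_; _,_)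
open import Data.Sum using (_⊎_; inj₁; inj₂)
open import Relation.Binary.PropositionalEquality using (_≡_; refl; sym; trans; cong; cong₂; subst; module ≡-Reasoning)
open import Relation.Nullary using (¬_; Dec)
open import Relation.Nullary.Decidable using (from-yes; _⊎-dec_)
open import Relation.Unary using (Decidable)
open import Defs

-- If n⁶ leaves the remainder r = s² on division by d, then
-- d ⌊n⁶/d⌋ = n⁶ − s² = (n³ − s)(n³ + s), and if r = c³, then
-- d ⌊n⁶/d⌋ = n⁶ − c³ = (n² − c)(n⁴ + c n² + c²).  For n ≥ 2d both factors
-- exceed d, so ⌊n⁶/d⌋ cannot be prime.  For the listed d every sixth power
-- has a square or a cube as its remainder.

-- Writing a = k p and cancelling p from d p = k p b leaves d = k b. Since a > 0 forces k ≥ 1, this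
-- gives b ≤ d.
prime∣⇒¬cofactor> : ∀ {d p a b} → Prime p → p ∣ a → 0 < a → d < b → ¬ (d * p ≡ a * b)
prime∣⇒¬cofactor> _ (divides-refl zero) ()
prime∣⇒¬cofactor> {d} {p} {_} {b} pp (divides-refl k@(suc _)) _ d<b eq =
  <⇒≱ d<b (subst (b ≤_) (sym d≡k*b) (m≤n*m b k))
  where
  instance _ = prime⇒nonZero pp
  d≡k*b : d ≡ k * b
  d≡k*b = *-cancelʳ-≡ d (k * b) p (trans eq (swap k p b))
    where
    swap : ∀ x y z → x * y * z ≡ x * z * y
    swap = solve-∀

-- A prime q would divide a or b by Euclid's lemma, and cancelling it would make the other factor a
-- divisor of d, although it exceeds d.
largeFactors⇒composite : ∀ {d q a b} → d < a → d < b → d * q ≡ a * b → Composite q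
largeFactors⇒composite {d} {q} {a} {b} d<a d<b eq = ¬prime⇒composite {{n>1⇒nonTrivial 1<q}} ¬prime
  where
  0<a = m<n⇒0<n d<a
  0<b = m<n⇒0<n d<b
  instance _ = >-nonZero 0<b

  1<q : 1 < q
  -- Non-primality alone does not exclude q = 0 and q = 1; the size of a does.
  1<q = ≰⇒> λ q≤1 → <⇒≱ d<a (begin
    a      ≤⟨ m≤m*n a b ⟩
    a * b  ≡⟨ eq ⟨
    d * q  ≤⟨ *-monoʳ-≤ d q≤1 ⟩
    d * 1  ≡⟨ *-identityʳ d ⟩
    d      ∎)
    where open ≤-Reasoning

  ¬prime : ¬ Prime q
  ¬prime pq with euclidsLemma a b pq (divides d (sym eq))
  ... | inj₁ q∣a = prime∣⇒¬cofactor> pq q∣a 0<a d<b eq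
  ... | inj₂ q∣b = prime∣⇒¬cofactor> pq q∣b 0<b d<a (trans eq (*-comm a b))

-- With a = m - s the cofactor m + s is a + 2s, so truncated subtraction occurs only in `a`.
composite-[m²∸s²]/d : ∀ {d q m s} → d + s < m → m ^ 2 ≡ s ^ 2 + q * d → Composite q
composite-[m²∸s²]/d {d} {q} {m} {s} d+s<m eq =
  largeFactors⇒composite d<a (≤-trans d<a (m≤m+n a (2 * s))) (+-cancelˡ-≡ (s ^ 2) _ _ (begin
    s ^ 2 + d * q              ≡⟨ cong (s ^ 2 +_) (*-comm d q) ⟩
    s ^ 2 + q * d              ≡⟨ eq ⟨
    m ^ 2                      ≡⟨ cong (_^ 2) (m∸n+n≡m s≤m) ⟨
    (a + s) ^ 2                ≡⟨ expand a s ⟩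
    s ^ 2 + a * (a + 2 * s)    ∎))
  where
  open ≡-Reasoning
  a = m ∸ s
  s≤m = ≤-trans (m≤n+m s d) (<⇒≤ d+s<m)
  d<a = m+n≤o⇒m≤o∸n (suc d) d+s<m
  -- The ring solver does not accept _^_ on ℕ, so the powers are unfolded.
  expand : ∀ x y → (x + y) * ((x + y) * 1) ≡ y * (y * 1) + x * (x + 2 * y)
  expand = solve-∀

composite-[m³∸c³]/d : ∀ {d q m c} → d + c < m → m ^ 3 ≡ c ^ 3 + q * d → Composite q
composite-[m³∸c³]/d {d} {q} {m} {c} d+c<m eq =
  largeFactors⇒composite d<a d<b (+-cancelˡ-≡ (c ^ 3) _ _ (begin
    c ^ 3 + d * q              ≡⟨ cong (c ^ 3 +_) (*-comm d q) ⟩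
    c ^ 3 + q * d              ≡⟨ eq ⟨
    m ^ 3                      ≡⟨ cong (_^ 3) (m∸n+n≡m c≤m) ⟨
    (a + c) ^ 3                ≡⟨ expand a c ⟩
    c ^ 3 + a * (a * a + (3 * a * c + 3 * c * c))    ∎))
  where
  open ≡-Reasoning
  a = m ∸ c
  c≤m = ≤-trans (m≤n+m c d) (<⇒≤ d+c<m)
  d<a = m+n≤o⇒m≤o∸n (suc d) d+c<m
  instance _ = >-nonZero (m<n⇒0<n d<a)
  -- This cofactor is m² + m c + c² rewritten with m = a + c; it is at least a² ≥ a > d.
  d<b : d < a * a + (3 * a * c + 3 * c * c)
  d<b = ≤-trans d<a (≤-trans (m≤m*n a a) (m≤m+n (a * a) _))
  expand : ∀ x y → (x + y) * ((x + y) * ((x + y) * 1)) ≡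
    y * (y * (y * 1)) + x * (x * x + (3 * x * y + 3 * y * y))
  expand = solve-∀

-- A root never exceeds its square or cube, so the bound loses nothing. It makes the search finite
-- and later keeps the root below d.
SquareOrCube : ℕ → Set
SquareOrCube r = (∃[ s ] (s < suc r × s ^ 2 ≡ r)) ⊎ (∃[ c ] (c < suc r × c ^ 3 ≡ r))

squareOrCube? : Decidable SquareOrCube
squareOrCube? r = anyUpTo? (λ s → s ^ 2 ≟ r) (suc r) ⊎-dec anyUpTo? (λ c → c ^ 3 ≟ r) (suc r)

-- Testing i < d covers all n, because n⁶ mod d depends only on n mod d.
SixthPowerResidues : (d : ℕ) .{{_ : NonZero d}} → Set
SixthPowerResidues d = ∀ {i} → i < d → SquareOrCube (i ^ 6 % d)

sixthPowerResidues? : (d : ℕ) .{{_ : NonZero d}} → Dec (SixthPowerResidues d)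
sixthPowerResidues? d = allUpTo? (λ i → squareOrCube? (i ^ 6 % d)) d

[m%d]^k%d≡m^k%d : ∀ m k d .{{_ : NonZero d}} → (m % d) ^ k % d ≡ m ^ k % d
[m%d]^k%d≡m^k%d m zero d = refl
[m%d]^k%d≡m^k%d m (suc k) d = begin
  (m % d * (m % d) ^ k) % d              ≡⟨ %-distribˡ-* (m % d) ((m % d) ^ k) d ⟩
  (m % d % d * ((m % d) ^ k % d)) % d    ≡⟨ cong (_% d) (cong₂ _*_ (m%n%n≡m%n m d) ([m%d]^k%d≡m^k%d m k d)) ⟩
  (m % d * (m ^ k % d)) % d              ≡⟨ %-distribˡ-* m (m ^ k) d ⟨
  (m * m ^ k) % d                        ∎
  where open ≡-Reasoning

sixthPowerResidues⇒eventuallyPrimeFree : (d : ℕ) .{{_ : NonZero d}} →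
  SixthPowerResidues d → EventuallyPrimeFree (λ n → n ^ 6 / d)
sixthPowerResidues⇒eventuallyPrimeFree d residues =
  -- A root t of the remainder satisfies t ≤ r < d, so d + t < 2d, and n ≥ 2d puts n² and n³ above d
  -- + t.
  d + d , ≤-trans (>-nonZero⁻¹ d) (m≤m+n d d) , composite
  where
  composite : ∀ n → d + d ≤ n → Composite (n ^ 6 / d)
  composite n 2d≤n = fromResidue (subst SquareOrCube ([m%d]^k%d≡m^k%d n 6 d) (residues (m%n<n n d)))
    where
    instance _ = >-nonZero (≤-trans (>-nonZero⁻¹ d) (≤-trans (m≤m+n d d) 2d≤n))

    power-large : ∀ k {t} → t < suc (n ^ 6 % d) → d + t < n ^ suc k
    power-large k {t} (s≤s t≤r) = begin-strict
      d + t      <⟨ +-monoʳ-< d (≤-<-trans t≤r (m%n<n (n ^ 6) d)) ⟩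
      d + d      ≤⟨ 2d≤n ⟩
      n          ≤⟨ m≤m*n n (n ^ k) {{m^n≢0 n k}} ⟩
      n ^ suc k  ∎
      where open ≤-Reasoning

    division : ∀ {x r} → x ≡ n ^ 6 → r ≡ n ^ 6 % d → x ≡ r + n ^ 6 / d * d
    division refl refl = m≡m%n+[m/n]*n (n ^ 6) d

    fromResidue : SquareOrCube (n ^ 6 % d) → Composite (n ^ 6 / d)
    fromResidue (inj₁ (s , s≤r , s²≡r)) =
      -- Here n⁶ is read as (n³)², and in the cube case below as (n²)³.
      composite-[m²∸s²]/d (power-large 2 s≤r) (division (^-*-assoc n 3 2) s²≡r)
    fromResidue (inj₂ (c , c≤r , c³≡r)) =
      composite-[m³∸c³]/d (power-large 1 c≤r) (division (^-*-assoc n 2 3) c³≡r)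

-- The finite check is evaluated during type checking. The `NonZero` instance sits inside the
-- predicate because `All` ranges over arbitrary naturals.
listedResidues : All (λ d → .{{_ : NonZero d}} → SixthPowerResidues d)
  (2 ∷ 3 ∷ 4 ∷ 5 ∷ 7 ∷ 8 ∷ 9 ∷ 12 ∷ 16 ∷ 24 ∷ 56 ∷ 72 ∷ [])
listedResidues =
  from-yes (sixthPowerResidues? 2) ∷ from-yes (sixthPowerResidues? 3) ∷
  from-yes (sixthPowerResidues? 4) ∷ from-yes (sixthPowerResidues? 5) ∷
  from-yes (sixthPowerResidues? 7) ∷ from-yes (sixthPowerResidues? 8) ∷
  from-yes (sixthPowerResidues? 9) ∷ from-yes (sixthPowerResidues? 12) ∷
  from-yes (sixthPowerResidues? 16) ∷ from-yes (sixthPowerResidues? 24) ∷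
  from-yes (sixthPowerResidues? 56) ∷ from-yes (sixthPowerResidues? 72) ∷ []

theorem4 : (d : ℕ) .{{_ : NonZero d}} →
    d ∈ (2 ∷ 3 ∷ 4 ∷ 5 ∷ 7 ∷ 8 ∷ 9 ∷ 12 ∷ 16 ∷ 24 ∷ 56 ∷ 72 ∷ []) →
    EventuallyPrimeFree (λ n → n ^ 6 / d)
theorem4 d d∈ = sixthPowerResidues⇒eventuallyPrimeFree d (lookup listedResidues d∈)
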